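{- For every $n\ge0$, $$P_n(t)=\sum_{\pi\in\mathcal C^\circ_{n+1}}t^{\mathrm{neg}(\pi)},\qquad Q_n(t)=\sum_{\pi\in\mathcal C_n}t^{\mathrm{neg}(\pi)},\qquad R_n(t)=\sum_{\substack{\pi\in\mathcal C^\circ_{n+2}\\ \pi_1>0}}t^{\mathrm{neg}(\pi)}.$$
   Context: $P_n,Q_n,R_n$ are the polynomials with $\frac{d^n}{dx^n}\tan x=P_n(\tan x)$, $\frac{d^n}{dx^n}\sec x=Q_n(\tan x)\sec x$, $\frac{d^n}{dx^n}\sec^2x=R_n(\tan x)\sec^2x$. A signed permutation of size $n$ is a bijection $\pi$ of $\{ -n,\dots,-1,1,\dots,n\}$ with $\pi(-i)=-\pi(i)$; $\pi_i=\pi(i)$. $\mathrm{neg}(\pi)$ is the number of $i\in\{1,\dots,n\}$ with $\pi_i<0$. A cycle of $\pi$ is an unordered pair of orbits $\{O,-O\}$ (possibly $O=-O$). An element $i$ is a cycle peak if $\pi^{ -1}(i)<i>\pi(i)$ and a cycle valley if $\pi^{ -1}(i)>i<\pi(i)$; $\pi$ is cycle-alternating if every element of $\{ -n,\dots,-1,1,\dots,n\}$ is a cycle peak or a cycle valley. $\mathcal C_n$ is the set of cycle-alternating signed permutations of size $n$ and $\mathcal C^\circ_n\subseteq\mathcal C_n$ the subset of those with exactly one cycle. -}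

module Defs where

open import Data.Nat using (ℕ; zero; suc; _+_; _*_; _≤_; _<_)
import Data.Nat.Properties as ℕP
open import Data.Fin using (Fin; toℕ)
import Data.Fin.Properties as FinP
open import Data.Sign using (Sign) renaming (_*_ to _*ₛ_)
import Data.Sign.Properties as SignP
open import Data.Integer using (ℤ; _◃_) renaming (_<_ to _<ℤ_)
import Data.Integer.Properties as ℤP
open import Data.Product using (Σ; ∃; _×_; _,_; proj₁; proj₂)
open import Data.Product.Properties using (≡-dec)
open import Data.Sum using (_⊎_; inj₁; inj₂)
open import Data.List using (List; []; _∷_; length; filter; map; concatMap; cartesianProduct)
open import Data.Vec using (Vec; lookup) renaming ([] to []ᵥ; _∷_ to _∷ᵥ_)
open import Relation.Nullary using (Dec; yes; no)
open import Relation.Nullary.Decidable using (_×-dec_; _⊎-dec_; _→-dec_; map′)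
open import Relation.Binary.PropositionalEquality using (_≡_; refl)

-- Polynomials with natural-number coefficients, as coefficient sequences
-- (p k = coefficient of t^k).

Poly : Set
Poly = ℕ → ℕ

𝟙 : Poly
𝟙 zero    = 1
𝟙 (suc _) = 0

𝕥 : Poly
𝕥 (suc zero) = 1
𝕥 _          = 0

_⊕_ : Poly → Poly → Poly
(p ⊕ q) k = p k + q k

t· : Poly → Poly
t· p zero    = 0
t· p (suc k) = p k

D : Poly → Poly
D p k = suc k * p (suc k)

[1+t²]· : Poly → Poly
[1+t²]· p = p ⊕ t· (t· p)

-- Derivative polynomials, defined by the chain rule with
-- d/dx tan x = 1 + tan² x, d/dx sec x = tan x sec x, d/dx sec² x = 2 tan x sec² x:
--   P_0 = t,  P_{n+1} = (1+t²) P_n'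
--   Q_0 = 1,  Q_{n+1} = (1+t²) Q_n' + t Q_n
--   R_0 = 1,  R_{n+1} = (1+t²) R_n' + 2t R_n
P : ℕ → Poly
P zero    = 𝕥
P (suc n) = [1+t²]· (D (P n))

Q : ℕ → Poly
Q zero    = 𝟙
Q (suc n) = [1+t²]· (D (Q n)) ⊕ t· (Q n)

R : ℕ → Poly
R zero    = 𝟙
R (suc n) = [1+t²]· (D (R n)) ⊕ (t· (R n) ⊕ t· (R n))

-- Signed permutations.
-- An element of {-n,…,-1,1,…,n} is a pair (s , i) : Sign × Fin n standing
-- for the integer s·(i+1).

Elem : ℕ → Set
Elem n = Sign × Fin n

toℤ : ∀ {n} → Elem n → ℤ
toℤ (s , i) = s ◃ suc (toℕ i)

neg₁ : ∀ {n} → Elem n → Elem n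
neg₁ (s , i) = (s *ₛ Sign.- , i)

-- A candidate signed permutation is given by its values on 1,…,n:
-- f i = π(i+1).  It is extended to negative arguments by π(-i) = -π(i).
Map : ℕ → Set
Map n = Fin n → Elem n

app : ∀ {n} → Map n → Elem n → Elem n
app f (s , i) = (s *ₛ proj₁ (f i) , proj₂ (f i))

-- π is a bijection of ±[n] iff i ↦ |π(i)| is a bijection (= injection) of [n].
IsSignedPerm : ∀ {n} → Map n → Set
IsSignedPerm {n} f = ∀ (i j : Fin n) → proj₂ (f i) ≡ proj₂ (f j) → i ≡ j

-- cycle peak: π⁻¹(x) < x > π(x);  cycle valley: π⁻¹(x) > x < π(x).
-- π⁻¹(x) is the (unique) y with π(y) = x.
IsCyclePeak : ∀ {n} → Map n → Elem n → Set
IsCyclePeak {n} f x =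
  (toℤ (app f x) <ℤ toℤ x) × (∀ (y : Elem n) → app f y ≡ x → toℤ y <ℤ toℤ x)

IsCycleValley : ∀ {n} → Map n → Elem n → Set
IsCycleValley {n} f x =
  (toℤ x <ℤ toℤ (app f x)) × (∀ (y : Elem n) → app f y ≡ x → toℤ x <ℤ toℤ y)

IsCycleAlternating : ∀ {n} → Map n → Set
IsCycleAlternating {n} f = ∀ (x : Elem n) → IsCyclePeak f x ⊎ IsCycleValley f x

iter : ∀ {n} → Map n → ℕ → Elem n → Elem n
iter f zero    x = x
iter f (suc k) x = app f (iter f k x)

-- exactly one cycle: ±[n] is nonempty and every y lies in the orbit of x or of -x
-- (orbits have length ≤ 2n, so exponents k < 2n suffice).
HasOneCycle : ∀ {n} → Map n → Set
HasOneCycle {n} f =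
  (1 ≤ n) × (∀ (x y : Elem n) → ∃ λ (k : Fin (n + n)) →
                 (iter f (toℕ k) x ≡ y) ⊎ (iter f (toℕ k) x ≡ neg₁ y))

negCount : ∀ {n} → Map n → ℕ
negCount {n} f = length (filter (λ i → proj₁ (f i) SignP.≟ Sign.-) (Data.List.allFin n))
  where import Data.List

_≟ₑ_ : ∀ {n} (x y : Elem n) → Dec (x ≡ y)
_≟ₑ_ = ≡-dec SignP._≟_ FinP._≟_

allElem? : ∀ {n} {A : Elem n → Set} → (∀ x → Dec (A x)) → Dec (∀ x → A x)
allElem? {n} {A} d =
  map′ (λ { (p , q) (Sign.+ , i) → p i ; (p , q) (Sign.- , i) → q i })
       (λ h → (λ i → h (Sign.+ , i)) , (λ i → h (Sign.- , i)))
       (FinP.all? (λ i → d (Sign.+ , i)) ×-dec FinP.all? (λ i → d (Sign.- , i)))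

isSignedPerm? : ∀ {n} (f : Map n) → Dec (IsSignedPerm f)
isSignedPerm? f = FinP.all? λ i → FinP.all? λ j →
  FinP._≟_ (proj₂ (f i)) (proj₂ (f j)) →-dec FinP._≟_ i j

isCycleAlternating? : ∀ {n} (f : Map n) → Dec (IsCycleAlternating f)
isCycleAlternating? f = allElem? λ x →
  ((toℤ (app f x) ℤP.<? toℤ x) ×-dec allElem? (λ y → (app f y ≟ₑ x) →-dec (toℤ y ℤP.<? toℤ x)))
  ⊎-dec
  ((toℤ x ℤP.<? toℤ (app f x)) ×-dec allElem? (λ y → (app f y ≟ₑ x) →-dec (toℤ x ℤP.<? toℤ y)))

hasOneCycle? : ∀ {n} (f : Map n) → Dec (HasOneCycle f)
hasOneCycle? {n} f = (1 ℕP.≤? n) ×-dec allElem? λ x → allElem? λ y →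
  FinP.any? λ k → (iter f (toℕ k) x ≟ₑ y) ⊎-dec (iter f (toℕ k) x ≟ₑ neg₁ y)

allVecs : ∀ {A : Set} (m : ℕ) → List A → List (Vec A m)
allVecs zero    xs = []ᵥ ∷ []
allVecs (suc m) xs = concatMap (λ x → map (x ∷ᵥ_) (allVecs m xs)) xs

allElems : (n : ℕ) → List (Elem n)
allElems n = cartesianProduct (Sign.+ ∷ Sign.- ∷ []) (Data.List.allFin n)
  where import Data.List

allMaps : (n : ℕ) → List (Map n)
allMaps n = map lookup (allVecs n (allElems n))

countSP : (n : ℕ) (C : Map n → Set) → (∀ f → Dec (C f)) → ℕ → ℕ
countSP n C C? k = length (filter
  (λ f → isSignedPerm? f ×-dec (C? f ×-dec (negCount f ℕP.≟ k))) (allMaps n))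

𝒞-coeff : ℕ → ℕ → ℕ
𝒞-coeff n = countSP n IsCycleAlternating isCycleAlternating?

𝒞°-coeff : ℕ → ℕ → ℕ
𝒞°-coeff n = countSP n (λ f → IsCycleAlternating f × HasOneCycle f)
  (λ f → isCycleAlternating? f ×-dec hasOneCycle? f)

𝒞°₊-coeff : ℕ → ℕ → ℕ
𝒞°₊-coeff n = countSP (suc n)
  (λ f → IsCycleAlternating f × HasOneCycle f × (proj₁ (f Fin.zero) ≡ Sign.+))
  (λ f → isCycleAlternating? f ×-dec hasOneCycle? f ×-dec (proj₁ (f Fin.zero) SignP.≟ Sign.+))
  where import Data.Fin as Fin

{-# OPTIONS --safe #-}
module Submission where

-- Removing the element 1 of smallest absolute value from a cycle-alternating π
-- gives a cycle-alternating permutation again: either π(1) = -1, or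
-- alternation forces i → s1 and 1 → sj with i, j > 0 and the same sign s, and
-- the two arrows are merged into the crossing arrow i → -j.  Conversely a
-- permutation with k negative values has k crossing arrows, and each may be
-- subdivided in two ways, with s = - (one more negative value) or s = + (one
-- less).  Subdivision preserves the cycles, whereas 1 → -1 → 1 is a new one, so
-- counting by neg yields (1+t²)p' for the one-cycle permutations and
-- (1+t²)p' + tp for all of them.  In the one-cycle case π₁ > 0 means s = +,
-- which counts p' = P_n' = R_n.

open import Defs
open import Data.Empty using (⊥; ⊥-elim)
open import Data.Fin using (Fin; zero; suc; toℕ; fromℕ<; punchOut; _<_)
open import Data.Fin.Properties
  using (_≟_; any?; toℕ-fromℕ<; toℕ<n; suc-injective; <-asym;
         pigeonhole; injective⇒≤; punchOut-injective)
open import Data.Integer using (+<+; -<-; -<+) renaming (_<_ to _<ℤ_)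
open import Data.List using (List; []; _∷_; _++_; length; filter; concatMap; allFin)
import Data.List as List
open import Data.List.Membership.Propositional using (_∈_; find; lose)
open import Data.List.Membership.Propositional.Properties
  using (∈-map⁺; ∈-map⁻; ∈-++⁺ˡ; ∈-++⁺ʳ; ∈-++⁻; ∈-concatMap⁺; ∈-concatMap⁻;
         ∈-filter⁺; ∈-filter⁻; ∈-allFin; ∈-cartesianProduct⁺)
open import Data.List.Membership.Propositional.Properties.WithK using (unique∧set⇒bag)
open import Data.List.Properties using (length-map; length-++; map-tabulate; filter-accept; filter-reject)
open import Data.List.Relation.Binary.BagAndSetEquality using (∼bag⇒↭)
open import Data.List.Relation.Binary.Permutation.Propositional.Properties using (↭-length)
import Data.List.Relation.Unary.All as All
open All using ([]; _∷_)
open import Data.List.Relation.Unary.AllPairs using ([]; _∷_)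
open import Data.List.Relation.Unary.Any using (here; there)
open import Data.List.Relation.Unary.Unique.Propositional using (Unique)
import Data.List.Relation.Unary.Unique.Propositional.Properties as Unique
open import Data.Nat using (ℕ; zero; suc; _+_; _*_; _∸_; z<s; s<s; s≤s; s≤s⁻¹)
import Data.Nat as ℕ
open import Data.Nat.GeneralisedArithmetic using (fold; fold-+)
import Data.Nat.Properties as ℕP
open import Data.Nat.Tactic.RingSolver using (solve-∀)
open import Data.Product using (∃; ∃₂; _×_; _,_; proj₁; proj₂)
open import Data.Sign using (Sign; opposite)
import Data.Sign.Properties as SignP
open import Data.Sum using (_⊎_; inj₁; inj₂)
import Data.Sum as Sum
open import Data.Unit using (⊤; tt)
open import Data.Vec using (Vec; []; _∷_; lookup; tabulate; _[_]≔_)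
import Data.Vec as Vec
open import Data.Vec.Properties
  using (lookup-map; lookup∘tabulate; tabulate∘lookup; tabulate-cong; lookup∘update; lookup∘update′;
         ∷-injectiveˡ; ∷-injectiveʳ)
open import Function using (_∘_; mk⇔)
open import Relation.Binary.Construct.Closure.ReflexiveTransitive using (Star; ε; _◅_; _◅◅_)
open import Relation.Binary.PropositionalEquality
  using (_≡_; _≢_; _≗_; refl; sym; trans; cong; cong₂; subst; module ≡-Reasoning)
open import Relation.Nullary using (Dec; yes; no; ¬_; contradiction)
open import Relation.Nullary.Decidable using (_×-dec_)
open import Relation.Unary using (Decidable)

-- Cycle alternation in terms of absolute values

Descends Ascends : ∀ {n} → Fin n → Elem n → Set
Descends j (Sign.- , _) = ⊤
Descends j (Sign.+ , l) = l < j
Ascends  j (Sign.- , _) = ⊥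
Ascends  j (Sign.+ , l) = j < l

-- Since - turns peaks into valleys, only arrows leaving positive elements
-- need to be inspected; a negative π(i) = -j makes i a peak, hence -j a
-- valley, hence j a peak.
ArrowAlternates : ∀ {n} → Map n → Fin n → Elem n → Set
ArrowAlternates f i (Sign.- , j) = Descends j (f j)
ArrowAlternates f i (Sign.+ , j) = (j < i × Ascends j (f j)) ⊎ (i < j × Descends j (f j))

Alternating : ∀ {n} → Map n → Set
Alternating f = ∀ i → ArrowAlternates f i (f i)

-- Alternation along the arrow leaving j excludes `f j` = +j, and any other value lies strictly
-- below or strictly above j.
descends-or-ascends : ∀ {n} {f : Map n} → Alternating f → ∀ j → Descends j (f j) ⊎ Ascends j (f j)
descends-or-ascends {f = f} alt j with f j | alt j
... | Sign.- , _ | _              = inj₁ tt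
... | Sign.+ , l | inj₁ (l<j , _) = inj₁ l<j
... | Sign.+ , l | inj₂ (j<l , _) = inj₂ j<l

¬descends∧ascends : ∀ {n} {j : Fin n} y → Descends j y → Ascends j y → ⊥
¬descends∧ascends (Sign.+ , l) l<j j<l = <-asym l<j j<l

module _ {n} {j : Fin n} where

  <⇒descends : ∀ y → toℤ y <ℤ toℤ (Sign.+ , j) → Descends j y
  <⇒descends (Sign.- , _) _              = tt
  <⇒descends (Sign.+ , l) (+<+ (s≤s l<j)) = l<j

  >⇒ascends : ∀ y → toℤ (Sign.+ , j) <ℤ toℤ y → Ascends j y
  >⇒ascends (Sign.+ , l) (+<+ (s≤s j<l)) = j<l

  descends⇒< : ∀ y → Descends j y → toℤ y <ℤ toℤ (Sign.+ , j)
  descends⇒< (Sign.- , _) _   = -<+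
  descends⇒< (Sign.+ , _) l<j = +<+ (s<s l<j)

  ascends⇒> : ∀ y → Ascends j y → toℤ (Sign.+ , j) <ℤ toℤ y
  ascends⇒> (Sign.+ , _) j<l = +<+ (s<s j<l)

  -- Negation reverses the order, so a descent at j is an ascent at -j. The value of `app f` at -j
  -- reduces to the form with `opposite s`.
  descends⇒neg> : ∀ s l → Descends j (s , l) → toℤ (Sign.- , j) <ℤ toℤ (opposite s , l)
  descends⇒neg> Sign.- _ _   = -<+
  descends⇒neg> Sign.+ _ l<j = -<- l<j

  ascends⇒neg< : ∀ s l → Ascends j (s , l) → toℤ (opposite s , l) <ℤ toℤ (Sign.- , j)
  ascends⇒neg< Sign.+ _ j<l = -<- j<l

-- The hypothesis is read at the positive element j = |π(i)|, whose preimage is i or -i according to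
-- the sign of π(i).
cycleAlternating⇒alternating : ∀ {n} {f : Map n} → IsCycleAlternating f → Alternating f
cycleAlternating⇒alternating {n} {f} alt i = arrow (f i) refl
  where
  arrow : ∀ y → f i ≡ y → ArrowAlternates f i y
  arrow (Sign.- , j) fi≡y with alt (Sign.+ , j)
  ... | inj₁ (fj<j , _) = <⇒descends (f j) fj<j
  -- Here π(-i) = j, so a valley at j would require j < -i.
  ... | inj₂ (_ , valley)
    with () ← valley (Sign.- , i) (cong (λ y → opposite (proj₁ y) , proj₂ y) fi≡y)
  arrow (Sign.+ , j) fi≡y with alt (Sign.+ , j)
  ... | inj₁ (fj<j , peak) = inj₂ (>⇒i<j (peak (Sign.+ , i) fi≡y) , <⇒descends (f j) fj<j)
    where
    >⇒i<j : toℤ (Sign.+ , i) <ℤ toℤ (Sign.+ , j) → i < j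
    >⇒i<j (+<+ (s≤s i<j)) = i<j
  ... | inj₂ (j<fj , valley) = inj₁ (>⇒j<i (valley (Sign.+ , i) fi≡y) , >⇒ascends (f j) j<fj)
    where
    >⇒j<i : toℤ (Sign.+ , j) <ℤ toℤ (Sign.+ , i) → j < i
    >⇒j<i (+<+ (s≤s j<i)) = j<i

module _ {n} {f : Map n} (alt : Alternating f) where

  private
    into : ∀ {i j} s → f i ≡ (s , j) → ArrowAlternates f i (s , j)
    into {i} s fi≡y = subst (ArrowAlternates f i) fi≡y (alt i)

    sign-neg : ∀ {i} {y : Elem n} → (opposite (proj₁ (f i)) , proj₂ (f i)) ≡ y →
               f i ≡ (opposite (proj₁ y) , proj₂ y)
    sign-neg {i} refl = cong (_, proj₂ (f i)) (sym (SignP.opposite-selfInverse refl))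

  -- In this and the next three lemmas the direction at j is known and the preimage must lie on the
  -- same side. A preimage of the same sign is placed by its own arrow. One of the opposite sign
  -- makes j descend: if j does descend it already lies on the right side, and if j ascends this is
  -- a contradiction.
  peak⁺ : ∀ {j} → Descends j (f j) → ∀ y → app f y ≡ (Sign.+ , j) → toℤ y <ℤ toℤ (Sign.+ , j)
  peak⁺ desc (Sign.- , i) _ = -<+
  peak⁺ {j} desc (Sign.+ , i) e with into Sign.+ e
  ... | inj₁ (_ , asc) = ⊥-elim (¬descends∧ascends (f j) desc asc)
  ... | inj₂ (i<j , _) = +<+ (s<s i<j)

  valley⁺ : ∀ {j} → Ascends j (f j) → ∀ y → app f y ≡ (Sign.+ , j) → toℤ (Sign.+ , j) <ℤ toℤ y
  valley⁺ {j} asc (Sign.- , i) e = ⊥-elim (¬descends∧ascends (f j) (into Sign.- (sign-neg e)) asc)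
  valley⁺ {j} asc (Sign.+ , i) e with into Sign.+ e
  ... | inj₁ (j<i , _)  = +<+ (s<s j<i)
  ... | inj₂ (_ , desc) = ⊥-elim (¬descends∧ascends (f j) desc asc)

  valley⁻ : ∀ {j} → Descends j (f j) → ∀ y → app f y ≡ (Sign.- , j) → toℤ (Sign.- , j) <ℤ toℤ y
  valley⁻ desc (Sign.+ , i) _ = -<+
  valley⁻ {j} desc (Sign.- , i) e with into Sign.+ (sign-neg e)
  ... | inj₁ (_ , asc) = ⊥-elim (¬descends∧ascends (f j) desc asc)
  ... | inj₂ (i<j , _) = -<- i<j

  peak⁻ : ∀ {j} → Ascends j (f j) → ∀ y → app f y ≡ (Sign.- , j) → toℤ y <ℤ toℤ (Sign.- , j)
  peak⁻ {j} asc (Sign.+ , i) e = ⊥-elim (¬descends∧ascends (f j) (into Sign.- e) asc)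
  peak⁻ {j} asc (Sign.- , i) e with into Sign.+ (sign-neg e)
  ... | inj₁ (j<i , _)  = -<- j<i
  ... | inj₂ (_ , desc) = ⊥-elim (¬descends∧ascends (f j) desc asc)

  alternating⇒cycleAlternating : IsCycleAlternating f
  alternating⇒cycleAlternating (s , j) with s | descends-or-ascends {f = f} alt j
  ... | Sign.+ | inj₁ desc = inj₁ (descends⇒< (f j) desc , peak⁺ desc)
  ... | Sign.+ | inj₂ asc  = inj₂ (ascends⇒> (f j) asc , valley⁺ asc)
  ... | Sign.- | inj₁ desc = inj₂ (descends⇒neg> _ _ desc , valley⁻ desc)
  ... | Sign.- | inj₂ asc  = inj₁ (ascends⇒neg< _ _ asc , peak⁻ asc)

-- Cycles in terms of absolute values

∣_∣ : ∀ {n} → Map n → Fin n → Fin n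
∣ f ∣ i = proj₂ (f i)

infix 4 _⊢_⟶_ _⊢_⟶*_

_⊢_⟶_ : ∀ {n} → Map n → Fin n → Fin n → Set
f ⊢ i ⟶ j = ∣ f ∣ i ≡ j

_⊢_⟶*_ : ∀ {n} → Map n → Fin n → Fin n → Set
f ⊢ i ⟶* j = Star (f ⊢_⟶_) i j

-- The cycles {O,-O} of π correspond to the cycles of |π|.
Transitive : ∀ {n} → Map n → Set
Transitive f = ∀ i j → f ⊢ i ⟶* j

⟶*-fold : ∀ {n} (f : Map n) i k → f ⊢ i ⟶* fold i ∣ f ∣ k
⟶*-fold f i zero    = ε
⟶*-fold f i (suc k) = ⟶*-fold f i k ◅◅ (refl ◅ ε)

fold-⟶* : ∀ {n} {f : Map n} {i j} → f ⊢ i ⟶* j → ∃ λ k → fold i ∣ f ∣ k ≡ j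
fold-⟶* ε = 0 , refl
fold-⟶* {f = f} {i} (refl ◅ i⟶*j) with k , e ← fold-⟶* {f = f} i⟶*j =
  -- The first arrow is the innermost application: `k + 1` stands for k further steps starting from
  -- `∣ f ∣ i`.
  k + 1 , trans (fold-+ i ∣ f ∣ k) e

∣iter∣ : ∀ {n} (f : Map n) k x → proj₂ (iter f k x) ≡ fold (proj₂ x) ∣ f ∣ k
∣iter∣ f zero    x = refl
∣iter∣ f (suc k) x = cong ∣ f ∣ (∣iter∣ f k x)

-- Two of the iterates with exponents 0, ..., n coincide, say for a < b. Applying n - b further
-- steps to both replaces the exponent n by n - b + a < n.
fold-period : ∀ {n} (σ : Fin n → Fin n) i → ∃ λ k → k ℕ.< n × fold i σ k ≡ fold i σ n
fold-period {n} σ i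
  with a , b , a<b , σᵃ≡σᵇ ← pigeonhole (ℕP.n<1+n n) (λ (a : Fin (suc n)) → fold i σ (toℕ a)) =
    (n ∸ toℕ b) + toℕ a
  , subst ((n ∸ toℕ b) + toℕ a ℕ.<_) (ℕP.m∸n+n≡m b≤n) (ℕP.+-monoʳ-< (n ∸ toℕ b) a<b)
  , (begin
      fold i σ ((n ∸ toℕ b) + toℕ a)          ≡⟨ fold-+ i σ (n ∸ toℕ b) ⟩
      fold (fold i σ (toℕ a)) σ (n ∸ toℕ b)   ≡⟨ cong (λ z → fold z σ (n ∸ toℕ b)) σᵃ≡σᵇ ⟩
      fold (fold i σ (toℕ b)) σ (n ∸ toℕ b)   ≡⟨ fold-+ i σ (n ∸ toℕ b) ⟨
      fold i σ ((n ∸ toℕ b) + toℕ b)          ≡⟨ cong (fold i σ) (ℕP.m∸n+n≡m b≤n) ⟩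
      fold i σ n                              ∎)
  where
  open ≡-Reasoning
  b≤n : toℕ b ℕ.≤ n
  b≤n = s≤s⁻¹ (toℕ<n b)

-- `HasOneCycle` admits bounded exponents only. The exponent is raised one step at a time and
-- brought back by `fold-period` whenever it reaches n.
fold-bounded : ∀ {n} (σ : Fin n → Fin n) i k → ∃ λ k′ → k′ ℕ.< n × fold i σ k′ ≡ fold i σ k
fold-bounded σ i zero = 0 , ℕP.≤-<-trans ℕ.z≤n (toℕ<n i) , refl
fold-bounded {n} σ i (suc k) with k′ , k′<n , e ← fold-bounded σ i k | ℕP.m≤n⇒m<n∨m≡n k′<n
... | inj₁ 1+k′<n = suc k′ , 1+k′<n , cong σ e
... | inj₂ refl with k″ , k″<n , e′ ← fold-period σ i = k″ , k″<n , trans e′ (cong σ e)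

equal-or-opposite : ∀ {n} (x y : Elem n) → proj₂ x ≡ proj₂ y → (x ≡ y) ⊎ (x ≡ neg₁ y)
equal-or-opposite (Sign.+ , _) (Sign.+ , _) refl = inj₁ refl
equal-or-opposite (Sign.+ , _) (Sign.- , _) refl = inj₂ refl
equal-or-opposite (Sign.- , _) (Sign.+ , _) refl = inj₂ refl
equal-or-opposite (Sign.- , _) (Sign.- , _) refl = inj₁ refl

-- Passing to absolute values loses only the sign of an iterate, and `HasOneCycle` accepts both y
-- and -y.
transitive⇒oneCycle : ∀ {n} {f : Map n} → 1 ℕ.≤ n → Transitive f → HasOneCycle f
transitive⇒oneCycle {n} {f} 1≤n trans-f = 1≤n , orbit
  where
  orbit : ∀ x y → ∃ λ (k : Fin (n + n)) → (iter f (toℕ k) x ≡ y) ⊎ (iter f (toℕ k) x ≡ neg₁ y)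
  orbit x y
    with k , σᵏx≡y ← fold-⟶* {f = f} (trans-f (proj₂ x) (proj₂ y))
    with k′ , k′<n , e ← fold-bounded ∣ f ∣ (proj₂ x) k =
    fromℕ< k′<n+n ,
    subst (λ m → (iter f m x ≡ y) ⊎ (iter f m x ≡ neg₁ y)) (sym (toℕ-fromℕ< k′<n+n))
      (equal-or-opposite (iter f k′ x) y (trans (∣iter∣ f k′ x) (trans e σᵏx≡y)))
    where
    k′<n+n = ℕP.<-≤-trans k′<n (ℕP.m≤m+n n n)

oneCycle⇒transitive : ∀ {n} {f : Map n} → HasOneCycle f → Transitive f
oneCycle⇒transitive {f = f} (_ , orbit) i j with orbit (Sign.+ , i) (Sign.+ , j)
... | k , e = subst (f ⊢ i ⟶*_) (trans (sym (∣iter∣ f (toℕ k) (Sign.+ , i))) (abs e))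
                    (⟶*-fold f i (toℕ k))
  where
  abs : ∀ {x} → (x ≡ (Sign.+ , j)) ⊎ (x ≡ (Sign.- , j)) → proj₂ x ≡ j
  abs (inj₁ refl) = refl
  abs (inj₂ refl) = refl

-- Insertion and removal of the element of smallest absolute value

↑ : ∀ {n} → Elem n → Elem (suc n)
↑ (s , i) = (s , suc i)

-- The crossing arrow i → -j of f is replaced by i → s1 together with
-- 1 → sj, all other absolute values being shifted by one.
record Insertion {n} (s : Sign) (i : Fin n) (f : Map n) (g : Map (suc n)) : Set where
  field
    crossing  : proj₁ (f i) ≡ Sign.-
    at-zero   : g zero ≡ (s , suc (∣ f ∣ i))
    at-i      : g (suc i) ≡ (s , zero)
    elsewhere : ∀ l → l ≢ i → g (suc l) ≡ ↑ (f l)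

record Fixing {n} (f : Map n) (g : Map (suc n)) : Set where
  field
    at-zero   : g zero ≡ (Sign.- , zero)
    elsewhere : ∀ l → g (suc l) ≡ ↑ (f l)

module _ {n} {l : Fin n} where

  ↑-descends : ∀ y → Descends l y → Descends (suc l) (↑ y)
  ↑-descends (Sign.- , _) _   = tt
  ↑-descends (Sign.+ , _) m<l = s<s m<l

  ↓-descends : ∀ y → Descends (suc l) (↑ y) → Descends l y
  ↓-descends (Sign.- , _) _         = tt
  ↓-descends (Sign.+ , _) (s≤s m<l) = m<l

  ↑-ascends : ∀ y → Ascends l y → Ascends (suc l) (↑ y)
  ↑-ascends (Sign.+ , _) l<m = s<s l<m

  ↓-ascends : ∀ y → Ascends (suc l) (↑ y) → Ascends l y
  ↓-ascends (Sign.+ , _) (s≤s l<m) = l<m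

crossing-descends : ∀ {n} {j : Fin n} y → proj₁ y ≡ Sign.- → Descends j y
crossing-descends (Sign.- , _) refl = tt

-- Shifting an arrow keeps the order of its ends, so its alternation carries over as soon as
-- descents and ascents at its target do. Fixing and insertion both supply these four facts.
module ArrowLift {n} {f : Map n} {g : Map (suc n)}
  (desc-↑ : ∀ l → Descends l (f l) → Descends (suc l) (g (suc l)))
  (desc-↓ : ∀ l → Descends (suc l) (g (suc l)) → Descends l (f l))
  (asc-↑ : ∀ l → Ascends l (f l) → Ascends (suc l) (g (suc l)))
  (asc-↓ : ∀ l → Ascends (suc l) (g (suc l)) → Ascends l (f l)) where

  ↑-arrow : ∀ {l} y → ArrowAlternates f l y → ArrowAlternates g (suc l) (↑ y)
  ↑-arrow (Sign.- , m) d                = desc-↑ m d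
  ↑-arrow (Sign.+ , m) (inj₁ (m<l , a)) = inj₁ (s<s m<l , asc-↑ m a)
  ↑-arrow (Sign.+ , m) (inj₂ (l<m , d)) = inj₂ (s<s l<m , desc-↑ m d)

  ↓-arrow : ∀ {l} y → ArrowAlternates g (suc l) (↑ y) → ArrowAlternates f l y
  ↓-arrow (Sign.- , m) d                      = desc-↓ m d
  ↓-arrow (Sign.+ , m) (inj₁ (s≤s m<l , a)) = inj₁ (m<l , asc-↓ m a)
  ↓-arrow (Sign.+ , m) (inj₂ (s≤s l<m , d)) = inj₂ (l<m , desc-↓ m d)

module _ {n} {f : Map n} {g : Map (suc n)} (fix : Fixing f g) where
  open Fixing fix

  open ArrowLift {f = f} {g}
    (λ l d → subst (Descends (suc l)) (sym (elsewhere l)) (↑-descends (f l) d))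
    (λ l d → ↓-descends (f l) (subst (Descends (suc l)) (elsewhere l) d))
    (λ l a → subst (Ascends (suc l)) (sym (elsewhere l)) (↑-ascends (f l) a))
    (λ l a → ↓-ascends (f l) (subst (Ascends (suc l)) (elsewhere l) a))

  fixing-alternating : Alternating f → Alternating g
  fixing-alternating alt zero =
    subst (ArrowAlternates g zero) (sym at-zero) (subst (Descends zero) (sym at-zero) tt)
  fixing-alternating alt (suc l) =
    subst (ArrowAlternates g (suc l)) (sym (elsewhere l)) (↑-arrow (f l) (alt l))

  fixing-alternating⁻ : Alternating g → Alternating f
  fixing-alternating⁻ alt l =
    ↓-arrow (f l) (subst (ArrowAlternates g (suc l)) (elsewhere l) (alt (suc l)))

  private
    ∣∣-zero : ∣ g ∣ zero ≡ zero
    ∣∣-zero = cong proj₂ at-zero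

    ∣∣-suc : ∀ l → ∣ g ∣ (suc l) ≡ suc (∣ f ∣ l)
    ∣∣-suc l = cong proj₂ (elsewhere l)

  fixing-signedPerm : IsSignedPerm f → IsSignedPerm g
  fixing-signedPerm inj zero    zero    _ = refl
  fixing-signedPerm inj zero    (suc m) e
    with () ← trans (sym ∣∣-zero) (trans e (∣∣-suc m))
  fixing-signedPerm inj (suc l) zero    e
    with () ← trans (sym ∣∣-zero) (trans (sym e) (∣∣-suc l))
  fixing-signedPerm inj (suc l) (suc m) e =
    cong suc (inj l m (suc-injective (trans (sym (∣∣-suc l)) (trans e (∣∣-suc m)))))

  fixing-signedPerm⁻ : IsSignedPerm g → IsSignedPerm f
  fixing-signedPerm⁻ inj l m e =
    suc-injective (inj (suc l) (suc m) (trans (∣∣-suc l) (trans (cong suc e) (sym (∣∣-suc m)))))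

  -- Paths from the element 1 never leave it, and `1 ≤ n` provides another absolute value.
  fixing-¬transitive : 1 ℕ.≤ n → ¬ Transitive g
  fixing-¬transitive (s≤s _) trans-g = stuck (trans-g zero (suc zero))
    where
    stuck : ∀ {j} → ¬ (g ⊢ zero ⟶* suc j)
    stuck (e ◅ r) with refl ← trans (sym ∣∣-zero) e = stuck r

module _ {n} {s} {i : Fin n} {f : Map n} {g : Map (suc n)} (ins : Insertion s i f g) where
  open Insertion ins

  private
    j : Fin n
    j = ∣ f ∣ i

    fi≡-j : f i ≡ (Sign.- , j)
    fi≡-j = cong (_, j) crossing

    -- The direction at i survives insertion: i descends along the crossing arrow to -j, and both 1
    -- and -1 lie below the shifted i.
    s1-descends : ∀ s → Descends (suc i) (s , zero)
    s1-descends Sign.- = tt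
    s1-descends Sign.+ = z<s

    ¬s1-ascends : ∀ s → ¬ Ascends (suc i) (s , zero)
    ¬s1-ascends Sign.+ ()

    desc-↑ : ∀ l → Descends l (f l) → Descends (suc l) (g (suc l))
    desc-↑ l d with l ≟ i
    ... | yes refl = subst (Descends (suc i)) (sym at-i) (s1-descends s)
    ... | no l≢i   = subst (Descends (suc l)) (sym (elsewhere l l≢i)) (↑-descends (f l) d)

    desc-↓ : ∀ l → Descends (suc l) (g (suc l)) → Descends l (f l)
    desc-↓ l d with l ≟ i
    ... | yes refl = crossing-descends (f i) crossing
    ... | no l≢i   = ↓-descends (f l) (subst (Descends (suc l)) (elsewhere l l≢i) d)

    asc-↑ : ∀ l → Ascends l (f l) → Ascends (suc l) (g (suc l))
    asc-↑ l a with l ≟ i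
    ... | yes refl = ⊥-elim (¬descends∧ascends (f i) (crossing-descends (f i) crossing) a)
    ... | no l≢i   = subst (Ascends (suc l)) (sym (elsewhere l l≢i)) (↑-ascends (f l) a)

    asc-↓ : ∀ l → Ascends (suc l) (g (suc l)) → Ascends l (f l)
    asc-↓ l a with l ≟ i
    ... | yes refl = ⊥-elim (¬s1-ascends s (subst (Ascends (suc i)) at-i a))
    ... | no l≢i   = ↓-ascends (f l) (subst (Ascends (suc l)) (elsewhere l l≢i) a)

    open ArrowLift {f = f} {g} desc-↑ desc-↓ asc-↑ asc-↓

  -- The crossing arrow i → -j already forces j to descend, which settles 1 → sj. For i → s1: if s =
  -- - then 1 descends to -j, and if s = + then 1 lies below both i and j.
  insertion-alternating : Alternating f → Alternating g
  insertion-alternating alt zero = subst (ArrowAlternates g zero) (sym at-zero) (arrow s)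
    where
    desc-j : Descends (suc j) (g (suc j))
    desc-j = desc-↑ j (subst (ArrowAlternates f i) fi≡-j (alt i))

    arrow : ∀ s → ArrowAlternates g zero (s , suc j)
    arrow Sign.- = desc-j
    arrow Sign.+ = inj₂ (z<s , desc-j)
  insertion-alternating alt (suc l) with l ≟ i
  ... | no l≢i   = subst (ArrowAlternates g (suc l)) (sym (elsewhere l l≢i)) (↑-arrow (f l) (alt l))
  ... | yes refl = subst (ArrowAlternates g (suc i)) (sym at-i) (arrow s at-zero)
    where
    arrow : ∀ s → g zero ≡ (s , suc j) → ArrowAlternates g (suc i) (s , zero)
    arrow Sign.- e = subst (Descends zero) (sym e) tt
    arrow Sign.+ e = inj₁ (z<s , subst (Ascends zero) (sym e) z<s)

  -- The restored arrow i → -j asks only for a descent at j. The arrow 1 → sj provides it, for s = +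
  -- because j cannot lie below 1.
  insertion-alternating⁻ : Alternating g → Alternating f
  insertion-alternating⁻ alt l with l ≟ i
  ... | no l≢i =
    ↓-arrow (f l) (subst (ArrowAlternates g (suc l)) (elsewhere l l≢i) (alt (suc l)))
  ... | yes refl = subst (ArrowAlternates f i) (sym fi≡-j) (desc-↓ j (desc-j s
                     (subst (ArrowAlternates g zero) at-zero (alt zero))))
    where
    desc-j : ∀ s → ArrowAlternates g zero (s , suc j) → Descends (suc j) (g (suc j))
    desc-j Sign.- d              = d
    desc-j Sign.+ (inj₂ (_ , d)) = d

  private
    ∣∣-zero : ∣ g ∣ zero ≡ suc j
    ∣∣-zero = cong proj₂ at-zero

    ∣∣-i : ∣ g ∣ (suc i) ≡ zero
    ∣∣-i = cong proj₂ at-i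

    ∣∣-suc : ∀ {l} → l ≢ i → ∣ g ∣ (suc l) ≡ suc (∣ f ∣ l)
    ∣∣-suc l≢i = cong proj₂ (elsewhere _ l≢i)

    ∣g∣-suc≢∣g∣-zero : IsSignedPerm f → ∀ l → ∣ g ∣ (suc l) ≢ ∣ g ∣ zero
    ∣g∣-suc≢∣g∣-zero inj l e with l ≟ i
    ... | yes refl with () ← trans (sym ∣∣-i) (trans e ∣∣-zero)
    ... | no l≢i =
      l≢i (inj l i (suc-injective (trans (sym (∣∣-suc l≢i)) (trans e ∣∣-zero))))

  insertion-signedPerm : IsSignedPerm f → IsSignedPerm g
  insertion-signedPerm inj zero    zero    _ = refl
  insertion-signedPerm inj zero    (suc m) e = ⊥-elim (∣g∣-suc≢∣g∣-zero inj m (sym e))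
  insertion-signedPerm inj (suc l) zero    e = ⊥-elim (∣g∣-suc≢∣g∣-zero inj l e)
  insertion-signedPerm inj (suc l) (suc m) e with l ≟ i | m ≟ i
  ... | yes refl | yes refl = refl
  ... | yes refl | no m≢i   with () ← trans (sym ∣∣-i) (trans e (∣∣-suc m≢i))
  ... | no l≢i   | yes refl with () ← trans (sym ∣∣-i) (trans (sym e) (∣∣-suc l≢i))
  ... | no l≢i   | no m≢i   =
    cong suc (inj l m (suc-injective (trans (sym (∣∣-suc l≢i)) (trans e (∣∣-suc m≢i)))))

  insertion-signedPerm⁻ : IsSignedPerm g → IsSignedPerm f
  insertion-signedPerm⁻ inj l m e with l ≟ i | m ≟ i
  ... | yes refl | yes refl = refl
  ... | yes refl | no m≢i
    with () ← inj zero (suc m) (trans ∣∣-zero (trans (cong suc e) (sym (∣∣-suc m≢i))))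
  ... | no l≢i   | yes refl
    with () ← inj (suc l) zero (trans (∣∣-suc l≢i) (trans (cong suc e) (sym ∣∣-zero)))
  ... | no l≢i   | no m≢i   =
    suc-injective (inj (suc l) (suc m)
      (trans (∣∣-suc l≢i) (trans (cong suc e) (sym (∣∣-suc m≢i)))))

  private
    -- The step out of i becomes the two steps i → 1 → j; all others stay single.
    lift-step : ∀ l → g ⊢ suc l ⟶* suc (∣ f ∣ l)
    lift-step l with l ≟ i
    ... | yes refl = ∣∣-i ◅ ∣∣-zero ◅ ε
    ... | no l≢i   = ∣∣-suc l≢i ◅ ε

    lift : ∀ {l m} → f ⊢ l ⟶* m → g ⊢ suc l ⟶* suc m
    lift ε          = ε
    lift (refl ◅ r) = lift-step _ ◅◅ lift r

    -- Identifying 1 with the target j turns i → 1 into the step i → j and 1 → j into the empty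
    -- path.
    collapse : Fin (suc n) → Fin n
    collapse zero    = j
    collapse (suc l) = l

    lower-step : ∀ x → f ⊢ collapse x ⟶* collapse (∣ g ∣ x)
    lower-step zero = subst (f ⊢ j ⟶*_) (sym (cong collapse ∣∣-zero)) ε
    lower-step (suc l) with l ≟ i
    ... | yes refl = sym (cong collapse ∣∣-i) ◅ ε
    ... | no l≢i   = sym (cong collapse (∣∣-suc l≢i)) ◅ ε

    lower : ∀ {x y} → g ⊢ x ⟶* y → f ⊢ collapse x ⟶* collapse y
    lower ε          = ε
    lower (refl ◅ r) = lower-step _ ◅◅ lower r

  -- The new element is entered from i and left towards j; lifted paths of f do the rest.
  insertion-transitive : Transitive f → Transitive g
  insertion-transitive trans-f zero    zero    = ε
  insertion-transitive trans-f zero    (suc m) = ∣∣-zero ◅ lift (trans-f j m)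
  insertion-transitive trans-f (suc l) zero    = lift (trans-f l i) ◅◅ (∣∣-i ◅ ε)
  insertion-transitive trans-f (suc l) (suc m) = lift (trans-f l m)

  insertion-transitive⁻ : Transitive g → Transitive f
  insertion-transitive⁻ trans-g l m = lower (trans-g (suc l) (suc m))

-- Decomposition of an alternating permutation at the element 1

unlift : ∀ {n} (y : Elem (suc n)) → proj₂ y ≢ zero → ∃ λ x → y ≡ ↑ x
unlift (s , zero)  y≢0 = contradiction refl y≢0
unlift (s , suc j) _   = (s , j) , refl

-- If `zero` were missed, punching it out would inject n + 1 elements into n.
injective⇒hits-zero : ∀ {n} {σ : Fin (suc n) → Fin (suc n)} → (∀ i j → σ i ≡ σ j → i ≡ j) →
                      ∃ λ i → σ i ≡ zero
injective⇒hits-zero {n} {σ} inj with any? (λ i → σ i ≟ zero)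
... | yes hit = hit
... | no ¬hit = contradiction (injective⇒≤ punched-injective) ℕP.1+n≰n
  where
  0≢σ : ∀ i → zero ≢ σ i
  0≢σ i 0≡σi = ¬hit (i , sym 0≡σi)

  punched-injective : ∀ {i j} → punchOut (0≢σ i) ≡ punchOut (0≢σ j) → i ≡ j
  punched-injective {i} {j} = inj i j ∘ punchOut-injective (0≢σ i) (0≢σ j)

-- The cases are distinguished by which absolute value is sent to 1: 1 itself gives a fixing, and
-- any other gives an insertion at that place.
alternating⇒fixed-or-inserted : ∀ {n} {g : Map (suc n)} → IsSignedPerm g → Alternating g →
  (∃ λ v → Fixing (lookup v) g) ⊎ (∃₂ λ s v → ∃ λ i → Insertion s i (lookup v) g)
alternating⇒fixed-or-inserted {n} {g} inj alt with injective⇒hits-zero inj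
... | zero , ∣g∣0≡0 = inj₁ (v , record { at-zero = g0≡-0 (g zero) refl ∣g∣0≡0 ; elsewhere = suc≡ })
  where
  lifted : ∀ l → ∃ λ x → g (suc l) ≡ ↑ x
  lifted l = unlift (g (suc l)) λ e → contradiction (inj (suc l) zero (trans e (sym ∣g∣0≡0))) λ ()

  v : Vec (Elem n) n
  v = tabulate (proj₁ ∘ lifted)

  suc≡ : ∀ l → g (suc l) ≡ ↑ (lookup v l)
  suc≡ l = trans (proj₂ (lifted l)) (cong ↑ (sym (lookup∘tabulate (proj₁ ∘ lifted) l)))

  -- The arrow 1 → 1 neither falls nor rises, so it cannot alternate.
  g0≡-0 : ∀ y → g zero ≡ y → proj₂ y ≡ zero → g zero ≡ (Sign.- , zero)
  g0≡-0 (Sign.- , zero) e refl = e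
  g0≡-0 (Sign.+ , zero) e refl with subst (ArrowAlternates g zero) e (alt zero)
  ... | inj₁ (() , _)
  ... | inj₂ (() , _)
... | suc i , ∣g∣i≡0 with g zero in g0≡ | g (suc i) in gi≡
-- Both 1 and i would be sent to absolute value 1.
...   | s₀ , zero  | s , m
  with () ← inj zero (suc i) (trans (cong proj₂ g0≡) (sym (trans (cong proj₂ gi≡) ∣g∣i≡0)))
...   | s₀ , suc j | s , zero = inj₂ (s , v , i , record
  { crossing  = cong proj₁ v-i
  ; at-zero   = trans g0≡ (cong₂ _,_
      (same-sign s s₀ g0≡ (subst (ArrowAlternates g (suc i)) gi≡ (alt (suc i))))
      (cong (suc ∘ proj₂) (sym v-i)))
  ; at-i      = gi≡
  ; elsewhere = suc≡
  })
  where
  -- The first clause is met only at the place i, where the merged crossing arrow to -j has to be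
  -- restored.
  lower : Elem (suc n) → Elem n
  lower (_ , zero)  = Sign.- , j
  lower (t , suc m) = t , m

  v : Vec (Elem n) n
  v = tabulate (lower ∘ g ∘ suc)

  v-i : lookup v i ≡ (Sign.- , j)
  v-i = trans (lookup∘tabulate (lower ∘ g ∘ suc) i) (cong lower gi≡)

  suc≡ : ∀ l → l ≢ i → g (suc l) ≡ ↑ (lookup v l)
  suc≡ l l≢i rewrite lookup∘tabulate (lower ∘ g ∘ suc) l = lift-lower (g (suc l)) refl
    where
    lift-lower : ∀ y → g (suc l) ≡ y → y ≡ ↑ (lower y)
    lift-lower (t , suc m) _ = refl
    lift-lower (t , zero)  e =
      contradiction
        (suc-injective (inj (suc l) (suc i) (trans (cong proj₂ e) (sym (cong proj₂ gi≡)))))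
        l≢i

  -- The arrow i → -1 asks for a descent at 1, impossible if 1 → +j. The arrow i → +1 falls and asks
  -- for an ascent at 1, impossible if 1 → -j.
  same-sign : ∀ s s₀ → g zero ≡ (s₀ , suc j) → ArrowAlternates g (suc i) (s , zero) → s₀ ≡ s
  same-sign Sign.- Sign.- _ _ = refl
  same-sign Sign.+ Sign.+ _ _ = refl
  same-sign Sign.- Sign.+ e d with () ← subst (Descends zero) e d
  same-sign Sign.+ Sign.- e (inj₁ (_ , a)) with () ← subst (Ascends zero) e a

-- Uniqueness of results and origins

insertion-functional : ∀ {n s} {i : Fin n} {f g g′} → Insertion s i f g → Insertion s i f g′ → g ≗ g′
insertion-functional ins ins′ zero =
  trans (Insertion.at-zero ins) (sym (Insertion.at-zero ins′))
insertion-functional {i = i} ins ins′ (suc l) with l ≟ i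
... | yes refl = trans (Insertion.at-i ins) (sym (Insertion.at-i ins′))
... | no l≢i   = trans (Insertion.elsewhere ins l l≢i) (sym (Insertion.elsewhere ins′ l l≢i))

fixing-functional : ∀ {n} {f : Map n} {g g′} → Fixing f g → Fixing f g′ → g ≗ g′
fixing-functional fix fix′ zero    = trans (Fixing.at-zero fix) (sym (Fixing.at-zero fix′))
fixing-functional fix fix′ (suc l) = trans (Fixing.elsewhere fix l) (sym (Fixing.elsewhere fix′ l))

↑-injective : ∀ {n} {x y : Elem n} → ↑ x ≡ ↑ y → x ≡ y
↑-injective {x = _ , _} {y = _ , _} refl = refl

-- The place i is recovered as the one other than 1 that `g` sends to absolute value 1, and the
-- target of the crossing arrow is recovered from `g zero`. Hence no permutation arises from two
-- origins.
insertion-injective : ∀ {n s} {i i′ : Fin n} {f f′ g} →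
                      Insertion s i f g → Insertion s i′ f′ g → i ≡ i′ × f ≗ f′
insertion-injective {i = i} {i′} {f} {f′} ins ins′ with i ≟ i′
... | no i≢i′
  with () ← trans (sym (Insertion.at-i ins)) (Insertion.elsewhere ins′ i i≢i′)
... | yes refl = refl , f≗f′
  where
  f≗f′ : f ≗ f′
  f≗f′ l with l ≟ i
  ... | no l≢i   =
    ↑-injective (trans (sym (Insertion.elsewhere ins l l≢i)) (Insertion.elsewhere ins′ l l≢i))
  ... | yes refl = cong₂ _,_
    (trans (Insertion.crossing ins) (sym (Insertion.crossing ins′)))
    (suc-injective (cong proj₂ (trans (sym (Insertion.at-zero ins)) (Insertion.at-zero ins′))))

-- Enumerations below run over vectors because there pointwise equality is equality.
lookup-injective : ∀ {A : Set} {n} {v w : Vec A n} → lookup v ≗ lookup w → v ≡ w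
lookup-injective {v = v} {w} v≗w =
  trans (sym (tabulate∘lookup v)) (trans (tabulate-cong v≗w) (tabulate∘lookup w))

-- Insertion and fixing on vectors of values

insertᵛ : ∀ {n} → Sign → Fin n → Vec (Elem n) n → Vec (Elem (suc n)) (suc n)
insertᵛ s i v = (s , suc (∣ lookup v ∣ i)) ∷ (Vec.map ↑ v [ i ]≔ (s , zero))

fixᵛ : ∀ {n} → Vec (Elem n) n → Vec (Elem (suc n)) (suc n)
fixᵛ v = (Sign.- , zero) ∷ Vec.map ↑ v

insertᵛ-insertion : ∀ {n} s (i : Fin n) v → proj₁ (lookup v i) ≡ Sign.- →
                    Insertion s i (lookup v) (lookup (insertᵛ s i v))
insertᵛ-insertion s i v crossing = record
  { crossing  = crossing
  ; at-zero   = refl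
  ; at-i      = lookup∘update i (Vec.map ↑ v) (s , zero)
  ; elsewhere = λ l l≢i → trans (lookup∘update′ l≢i (Vec.map ↑ v) (s , zero)) (lookup-map l ↑ v)
  }

fixᵛ-fixing : ∀ {n} (v : Vec (Elem n) n) → Fixing (lookup v) (lookup (fixᵛ v))
fixᵛ-fixing v = record { at-zero = refl ; elsewhere = λ l → lookup-map l ↑ v }

fixᵛ-injective : ∀ {n} {v v′ : Vec (Elem n) n} → fixᵛ v ≡ fixᵛ v′ → v ≡ v′
fixᵛ-injective {v = v} {v′} e = lookup-injective λ l → ↑-injective (begin
  ↑ (lookup v l)           ≡⟨ lookup-map l ↑ v ⟨
  lookup (Vec.map ↑ v) l   ≡⟨ cong (λ w → lookup w l) (∷-injectiveʳ e) ⟩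
  lookup (Vec.map ↑ v′) l  ≡⟨ lookup-map l ↑ v′ ⟩
  ↑ (lookup v′ l)          ∎)
  where open ≡-Reasoning

-- Negative values

length-filter-map : ∀ {A B : Set} {P : B → Set} (P? : Decidable P) (f : A → B) xs →
                    length (filter P? (List.map f xs)) ≡ length (filter (P? ∘ f) xs)
length-filter-map P? f []       = refl
length-filter-map P? f (x ∷ xs) with P? (f x)
... | yes _ = cong suc (length-filter-map P? f xs)
... | no  _ = length-filter-map P? f xs

negatives : ∀ {m} → (Fin m → Sign) → List (Fin m)
negatives ς = filter (λ i → ς i SignP.≟ Sign.-) (allFin _)

#negatives : ∀ {m} → (Fin m → Sign) → ℕ
#negatives ς = length (negatives ς)

private
  tail-negatives : ∀ {m} (ς : Fin (suc m) → Sign) →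
    length (filter (λ i → ς i SignP.≟ Sign.-) (List.tabulate suc)) ≡ #negatives (ς ∘ suc)
  tail-negatives {m} ς = trans
    (cong (λ xs → length (filter (λ i → ς i SignP.≟ Sign.-) xs)) (sym (map-tabulate {n = m} (λ i → i) suc)))
    (length-filter-map (λ i → ς i SignP.≟ Sign.-) suc (allFin m))

#negatives-neg : ∀ {m} (ς : Fin (suc m) → Sign) → ς zero ≡ Sign.- →
                 #negatives ς ≡ suc (#negatives (ς ∘ suc))
#negatives-neg ς e = trans
  (cong length (filter-accept (λ i → ς i SignP.≟ Sign.-) e))
  (cong suc (tail-negatives ς))

#negatives-pos : ∀ {m} (ς : Fin (suc m) → Sign) → ς zero ≡ Sign.+ →
                 #negatives ς ≡ #negatives (ς ∘ suc)
#negatives-pos ς e = trans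
  (cong length (filter-reject (λ i → ς i SignP.≟ Sign.-) λ e′ → contradiction (trans (sym e) e′) λ ()))
  (tail-negatives ς)

-- Common induction step, with k = 0 for `#negatives-cong` and k = 1 for `#negatives-flip`.
#negatives-suc : ∀ {m} (ς τ : Fin (suc m) → Sign) k → ς zero ≡ τ zero →
                 #negatives (ς ∘ suc) ≡ k + #negatives (τ ∘ suc) → #negatives ς ≡ k + #negatives τ
#negatives-suc ς τ k ς₀≡τ₀ e = by-sign (τ zero) refl
  where
  by-sign : ∀ s → τ zero ≡ s → #negatives ς ≡ k + #negatives τ
  by-sign Sign.+ τ₀ rewrite #negatives-pos τ τ₀ = trans (#negatives-pos ς (trans ς₀≡τ₀ τ₀)) e
  by-sign Sign.- τ₀ rewrite #negatives-neg τ τ₀ =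
    trans (#negatives-neg ς (trans ς₀≡τ₀ τ₀)) (trans (cong suc e) (sym (ℕP.+-suc k _)))

#negatives-cong : ∀ {m} (ς τ : Fin m → Sign) → ς ≗ τ → #negatives ς ≡ #negatives τ
#negatives-cong {zero}  ς τ ς≗τ = refl
#negatives-cong {suc m} ς τ ς≗τ =
  #negatives-suc ς τ 0 (ς≗τ zero) (#negatives-cong (ς ∘ suc) (τ ∘ suc) (ς≗τ ∘ suc))

#negatives-flip : ∀ {m} (ς τ : Fin m → Sign) i → ς i ≡ Sign.- → τ i ≡ Sign.+ →
                  (∀ l → l ≢ i → ς l ≡ τ l) → #negatives ς ≡ suc (#negatives τ)
#negatives-flip ς τ zero ςi τi agree =
  trans (#negatives-neg ς ςi)
    (cong suc (trans (#negatives-cong (ς ∘ suc) (τ ∘ suc) λ l → agree (suc l) λ ()) (sym (#negatives-pos τ τi))))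
#negatives-flip ς τ (suc i) ςi τi agree =
  #negatives-suc ς τ 1 (agree zero λ ())
    (#negatives-flip (ς ∘ suc) (τ ∘ suc) i ςi τi λ l l≢i → agree (suc l) (l≢i ∘ suc-injective))

fixing-negCount : ∀ {n} {f : Map n} {g} → Fixing f g → negCount g ≡ suc (negCount f)
fixing-negCount {f = f} {g} fix = trans
  (#negatives-neg (proj₁ ∘ g) (cong proj₁ at-zero))
  (cong suc (#negatives-cong (proj₁ ∘ g ∘ suc) (proj₁ ∘ f) (cong proj₁ ∘ elsewhere)))
  where open Fixing fix

-- The value at i stays negative, and 1 → -j is an additional negative value.
insertion⁻-negCount : ∀ {n} {i : Fin n} {f g} → Insertion Sign.- i f g → negCount g ≡ suc (negCount f)
insertion⁻-negCount {i = i} {f} {g} ins = trans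
  (#negatives-neg (proj₁ ∘ g) (cong proj₁ at-zero))
  (cong suc (#negatives-cong (proj₁ ∘ g ∘ suc) (proj₁ ∘ f) same))
  where
  open Insertion ins
  same : proj₁ ∘ g ∘ suc ≗ proj₁ ∘ f
  same l with l ≟ i
  ... | yes refl = trans (cong proj₁ at-i) (sym crossing)
  ... | no l≢i   = cong proj₁ (elsewhere l l≢i)

-- The value at i turns from negative to positive, and the new value at 1 is positive.
insertion⁺-negCount : ∀ {n} {i : Fin n} {f g} → Insertion Sign.+ i f g → negCount f ≡ suc (negCount g)
insertion⁺-negCount {i = i} {f} {g} ins = trans
  (#negatives-flip (proj₁ ∘ f) (proj₁ ∘ g ∘ suc) i crossing (cong proj₁ at-i)
    (λ l l≢i → sym (cong proj₁ (elsewhere l l≢i))))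
  (cong suc (sym (#negatives-pos (proj₁ ∘ g) (cong proj₁ at-zero))))
  where open Insertion ins

-- Enumerations

record Enumeration {A : Set} (G : A → Set) : Set where
  field
    list     : List A
    unique   : Unique list
    sound    : ∀ {x} → x ∈ list → G x
    complete : ∀ {x} → G x → x ∈ list

  size : ℕ
  size = length list

open Enumeration using (size)

-- Duplicate-free lists with the same members are permutations of each other.
size-cong : ∀ {A : Set} {G H : A → Set} (E : Enumeration G) (F : Enumeration H) →
            (∀ {x} → G x → H x) → (∀ {x} → H x → G x) → size E ≡ size F
size-cong E F G⇒H H⇒G = ↭-length (∼bag⇒↭ (unique∧set⇒bag E.unique F.unique
  (mk⇔ (F.complete ∘ G⇒H ∘ E.sound) (E.complete ∘ H⇒G ∘ F.sound))))
  where
  module E = Enumeration E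
  module F = Enumeration F

_⊎ᴱ_by_ : ∀ {A : Set} {G H : A → Set} → Enumeration G → Enumeration H →
          (∀ {x} → G x → ¬ H x) → Enumeration (λ x → G x ⊎ H x)
E ⊎ᴱ F by disjoint = record
  { list     = E.list ++ F.list
  ; unique   = Unique.++⁺ E.unique F.unique (λ (p , q) → disjoint (E.sound p) (F.sound q))
  ; sound    = Sum.map E.sound F.sound ∘ ∈-++⁻ E.list
  ; complete = Sum.[ ∈-++⁺ˡ ∘ E.complete , ∈-++⁺ʳ E.list ∘ F.complete ]
  }
  where
  module E = Enumeration E
  module F = Enumeration F

unique-concatMap : ∀ {A B : Set} (f : A → List B) → (∀ x → Unique (f x)) →
                   (∀ {x y z} → z ∈ f x → z ∈ f y → x ≡ y) →
                   ∀ {xs} → Unique xs → Unique (concatMap f xs)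
unique-concatMap f f! disjoint []                       = []
unique-concatMap f f! disjoint {x ∷ xs} (x∉xs ∷ xs!) =
  Unique.++⁺ (f! x) (unique-concatMap f f! disjoint xs!) λ (z∈fx , z∈rest) →
    let y , y∈xs , z∈fy = find (∈-concatMap⁻ f z∈rest)
    in All.lookup x∉xs y∈xs (disjoint z∈fx z∈fy)

length-concatMap : ∀ {A B : Set} (f : A → List B) {k} xs → (∀ {x} → x ∈ xs → length (f x) ≡ k) →
                   length (concatMap f xs) ≡ length xs * k
length-concatMap f []       _   = refl
length-concatMap f (x ∷ xs) len = trans (length-++ (f x))
  (cong₂ _+_ (len (here refl)) (length-concatMap f xs (len ∘ there)))

module _ {A : Set} {xs : List A} where

  ∈-allVecs : (∀ x → x ∈ xs) → ∀ {m} (v : Vec A m) → v ∈ allVecs m xs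
  ∈-allVecs all []      = here refl
  ∈-allVecs all (x ∷ v) =
    ∈-concatMap⁺ (λ x → List.map (x ∷_) (allVecs _ xs)) (lose (all x) (∈-map⁺ (x ∷_) (∈-allVecs all v)))

  unique-allVecs : Unique xs → ∀ m → Unique (allVecs m xs)
  unique-allVecs xs! zero    = [] ∷ []
  unique-allVecs xs! (suc m) = unique-concatMap _
    (λ x → Unique.map⁺ ∷-injectiveʳ (unique-allVecs xs! m))
    (λ {x} {y} z∈x z∈y →
      let _ , _ , z≡x∷v = ∈-map⁻ (x ∷_) z∈x
          _ , _ , z≡y∷w = ∈-map⁻ (y ∷_) z∈y
      in ∷-injectiveˡ (trans (sym z≡x∷v) z≡y∷w))
    xs!

∈-allElems : ∀ {n} (x : Elem n) → x ∈ allElems n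
∈-allElems (Sign.+ , i) = ∈-cartesianProduct⁺ {xs = Sign.+ ∷ Sign.- ∷ []} (here refl) (∈-allFin i)
∈-allElems (Sign.- , i) = ∈-cartesianProduct⁺ {xs = Sign.+ ∷ Sign.- ∷ []} (there (here refl)) (∈-allFin i)

unique-allElems : ∀ n → Unique (allElems n)
unique-allElems n = Unique.cartesianProduct⁺ (((λ ()) ∷ []) ∷ [] ∷ []) (Unique.allFin⁺ n)

record Solution {n} (C : Map n → Set) (k : ℕ) (v : Vec (Elem n) n) : Set where
  constructor solution
  field
    signedPerm : IsSignedPerm (lookup v)
    satisfies  : C (lookup v)
    #negative  : negCount (lookup v) ≡ k

module _ {n} {C : Map n → Set} where

  module _ (C? : ∀ f → Dec (C f)) (k : ℕ) where

    private
      solution? : ∀ f → Dec (IsSignedPerm f × C f × negCount f ≡ k)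
      solution? f = isSignedPerm? f ×-dec (C? f ×-dec (negCount f ℕP.≟ k))

    solutions : Enumeration (Solution C k)
    solutions = record
      { list     = filter (solution? ∘ lookup) (allVecs n (allElems n))
      ; unique   = Unique.filter⁺ (solution? ∘ lookup) (unique-allVecs (unique-allElems n) n)
      ; sound    = λ v∈ →
          let perm , Cv , #v = proj₂ (∈-filter⁻ (solution? ∘ lookup) {xs = allVecs n (allElems n)} v∈)
          in solution perm Cv #v
      ; complete = λ (solution perm Cv #v) →
          ∈-filter⁺ (solution? ∘ lookup) (∈-allVecs ∈-allElems _) (perm , Cv , #v)
      }

    -- `countSP` filters the functions `lookup v`; the test may equally be applied to v before the
    -- mapping.
    countSP-size : countSP n C C? k ≡ size solutions
    countSP-size = length-filter-map solution? lookup (allVecs n (allElems n))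

-- Enumeration of insertions and fixings

record Inserted {n} (s : Sign) (G : Vec (Elem n) n → Set) (w : Vec (Elem (suc n)) (suc n)) : Set where
  constructor inserting
  field
    {origin}  : Vec (Elem n) n
    {place}   : Fin n
    holds     : G origin
    insertion : Insertion s place (lookup origin) (lookup w)

record Fixed {n} (G : Vec (Elem n) n → Set) (w : Vec (Elem (suc n)) (suc n)) : Set where
  constructor fixing
  field
    {origin} : Vec (Elem n) n
    holds    : G origin
    fixing′  : Fixing (lookup origin) (lookup w)

fixed : ∀ {n} {G : Vec (Elem n) n → Set} → Enumeration G → Enumeration (Fixed G)
fixed {G = G} E = record
  { list     = List.map fixᵛ list
  ; unique   = Unique.map⁺ fixᵛ-injective unique
  ; sound    = sound′
  ; complete = λ (fixing {v} Gv fix) →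
      subst (_∈ List.map fixᵛ list) (lookup-injective (fixing-functional (fixᵛ-fixing v) fix))
        (∈-map⁺ fixᵛ (complete Gv))
  }
  where
  open Enumeration E
  sound′ : ∀ {w} → w ∈ List.map fixᵛ list → Fixed G w
  sound′ w∈ with v , v∈ , refl ← ∈-map⁻ fixᵛ w∈ = fixing (sound v∈) (fixᵛ-fixing v)

module _ {n : ℕ} (s : Sign) where

  insertionsInto : Vec (Elem n) n → List (Vec (Elem (suc n)) (suc n))
  insertionsInto v = List.map (λ i → insertᵛ s i v) (negatives (proj₁ ∘ lookup v))

  ∈-insertionsInto⁻ : ∀ {v w} → w ∈ insertionsInto v → ∃ λ i → Insertion s i (lookup v) (lookup w)
  ∈-insertionsInto⁻ {v} w∈
    with i , i∈ , refl ← ∈-map⁻ (λ i → insertᵛ s i v) w∈ =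
      i , insertᵛ-insertion s i v
          (proj₂ (∈-filter⁻ (λ i → proj₁ (lookup v i) SignP.≟ Sign.-) {xs = allFin n} i∈))

  ∈-insertionsInto⁺ : ∀ {v w i} → Insertion s i (lookup v) (lookup w) → w ∈ insertionsInto v
  ∈-insertionsInto⁺ {v} {w} {i} ins =
    subst (_∈ insertionsInto v)
      (lookup-injective (insertion-functional (insertᵛ-insertion s i v (Insertion.crossing ins)) ins))
      (∈-map⁺ (λ i → insertᵛ s i v)
        (∈-filter⁺ (λ i → proj₁ (lookup v i) SignP.≟ Sign.-) (∈-allFin i) (Insertion.crossing ins)))

  unique-insertionsInto : ∀ v → Unique (insertionsInto v)
  unique-insertionsInto v = Unique.map⁺ injective
    (Unique.filter⁺ (λ i → proj₁ (lookup v i) SignP.≟ Sign.-) (Unique.allFin⁺ n))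
    where
    injective : ∀ {i i′} → insertᵛ s i v ≡ insertᵛ s i′ v → i ≡ i′
    injective {i} {i′} e with i ≟ i′
    ... | yes i≡i′ = i≡i′
    ... | no i≢i′  = contradiction zero≡suc λ ()
      where
      open ≡-Reasoning
      -- The two vectors are compared at i: one has the new element there, the other a shifted old
      -- value.
      zero≡suc : zero ≡ suc (∣ lookup v ∣ i)
      zero≡suc = begin
        zero
          ≡⟨ cong proj₂ (lookup∘update i (Vec.map ↑ v) (s , zero)) ⟨
        proj₂ (lookup (Vec.map ↑ v [ i ]≔ (s , zero)) i)
          ≡⟨ cong (λ w → proj₂ (lookup w i)) (∷-injectiveʳ e) ⟩
        proj₂ (lookup (Vec.map ↑ v [ i′ ]≔ (s , zero)) i)
          ≡⟨ cong proj₂ (lookup∘update′ i≢i′ (Vec.map ↑ v) (s , zero)) ⟩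
        proj₂ (lookup (Vec.map ↑ v) i)
          ≡⟨ cong proj₂ (lookup-map i ↑ v) ⟩
        suc (∣ lookup v ∣ i)
          ∎

  inserted : ∀ {G : Vec (Elem n) n → Set} → Enumeration G → Enumeration (Inserted s G)
  inserted {G} E = record
    { list     = concatMap insertionsInto list
    ; unique   = unique-concatMap insertionsInto unique-insertionsInto
        (λ z∈x z∈y → lookup-injective
          (proj₂ (insertion-injective (proj₂ (∈-insertionsInto⁻ z∈x)) (proj₂ (∈-insertionsInto⁻ z∈y)))))
        unique
    ; sound    = λ w∈ →
        let v , v∈ , w∈v = find (∈-concatMap⁻ insertionsInto w∈)
            i , ins = ∈-insertionsInto⁻ w∈v
        in inserting (sound v∈) ins
    ; complete = λ (inserting Gv ins) →
        ∈-concatMap⁺ insertionsInto (lose (complete Gv) (∈-insertionsInto⁺ ins))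
    }
    where open Enumeration E

  -- Each origin has one insertion per crossing arrow, that is, per negative value. This is the
  -- factor produced by differentiating t^k.
  size-inserted : ∀ {k} {G : Vec (Elem n) n → Set} (E : Enumeration G) →
                  (∀ {v} → G v → negCount (lookup v) ≡ k) → size (inserted E) ≡ size E * k
  size-inserted E #neg = length-concatMap insertionsInto list λ {v} v∈ →
    trans (length-map (λ i → insertᵛ s i v) (negatives (proj₁ ∘ lookup v))) (#neg (sound v∈))
    where open Enumeration E

-- Recurrences

-- F collects the maps that may be extended by the two-element cycle 1 → -1 → 1.
module Recurrence {n} {C F : Map n → Set} {C′ : Map (suc n) → Set}
  (C? : ∀ f → Dec (C f)) (F? : ∀ f → Dec (F f)) (C′? : ∀ g → Dec (C′ g))
  (alternating : ∀ {g} → C′ g → Alternating g)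
  (insert⁺ : ∀ {s i f g} → Insertion s i f g → C f → C′ g)
  (insert⁻ : ∀ {s i f g} → Insertion s i f g → C′ g → C f)
  (fix⁺ : ∀ {f g} → Fixing f g → F f → C′ g)
  (fix⁻ : ∀ {f g} → Fixing f g → C′ g → F f) where

  private
    sol⁺ : ∀ {k w} → Inserted Sign.+ (Solution C (suc k)) w → Solution C′ k w
    sol⁺ (inserting (solution perm Cv #v) ins) = solution
      (insertion-signedPerm ins perm)
      (insert⁺ ins Cv)
      (ℕP.suc-injective (trans (sym (insertion⁺-negCount ins)) #v))

    sol⁻ : ∀ {k w} → Inserted Sign.- (Solution C k) w → Solution C′ (suc k) w
    sol⁻ (inserting (solution perm Cv #v) ins) = solution
      (insertion-signedPerm ins perm)
      (insert⁺ ins Cv)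
      (trans (insertion⁻-negCount ins) (cong suc #v))

    sol° : ∀ {k w} → Fixed (Solution F k) w → Solution C′ (suc k) w
    sol° (fixing (solution perm Fv #v) fix) = solution
      (fixing-signedPerm fix perm)
      (fix⁺ fix Fv)
      (trans (fixing-negCount fix) (cong suc #v))

    -- An insertion with s = + comes from an origin with one more negative value. The two other
    -- kinds come from one fewer, so for them k is a successor.
    classify : ∀ {k w} → Solution C′ k w →
      Inserted Sign.+ (Solution C (suc k)) w ⊎
      ∃ λ m → k ≡ suc m × (Inserted Sign.- (Solution C m) w ⊎ Fixed (Solution F m) w)
    classify (solution perm C′w refl) with alternating⇒fixed-or-inserted perm (alternating C′w)
    ... | inj₁ (v , fix) = inj₂ (_ , fixing-negCount fix ,
      inj₂ (fixing {origin = v} (solution (fixing-signedPerm⁻ fix perm) (fix⁻ fix C′w) refl) fix))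
    ... | inj₂ (Sign.- , v , i , ins) = inj₂ (_ , insertion⁻-negCount ins ,
      inj₁ (inserting {origin = v} (solution (insertion-signedPerm⁻ ins perm) (insert⁻ ins C′w) refl) ins))
    ... | inj₂ (Sign.+ , v , i , ins) = inj₁
      (inserting {origin = v}
        (solution (insertion-signedPerm⁻ ins perm) (insert⁻ ins C′w) (insertion⁺-negCount ins)) ins)

    E⁺ : ∀ k → Enumeration (Inserted Sign.+ (Solution C (suc k)))
    E⁺ k = inserted Sign.+ (solutions C? (suc k))

    size-E⁺ : ∀ k → size (E⁺ k) ≡ suc k * countSP n C C? (suc k)
    size-E⁺ k = begin
      size (E⁺ k)                           ≡⟨ size-inserted Sign.+ (solutions C? (suc k)) Solution.#negative ⟩
      size (solutions C? (suc k)) * suc k   ≡⟨ ℕP.*-comm (size (solutions C? (suc k))) (suc k) ⟩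
      suc k * size (solutions C? (suc k))   ≡⟨ cong (suc k *_) (countSP-size C? (suc k)) ⟨
      suc k * countSP n C C? (suc k)        ∎
      where open ≡-Reasoning

    E⁻ : ∀ k → Enumeration (Inserted Sign.- (Solution C k))
    E⁻ k = inserted Sign.- (solutions C? k)

    size-E⁻ : ∀ k → size (E⁻ k) ≡ k * countSP n C C? k
    size-E⁻ k = begin
      size (E⁻ k)                 ≡⟨ size-inserted Sign.- (solutions C? k) Solution.#negative ⟩
      size (solutions C? k) * k   ≡⟨ ℕP.*-comm (size (solutions C? k)) k ⟩
      k * size (solutions C? k)   ≡⟨ cong (k *_) (countSP-size C? k) ⟨
      k * countSP n C C? k        ∎
      where open ≡-Reasoning

    E° : ∀ k → Enumeration (Fixed (Solution F k))
    E° k = fixed (solutions F? k)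

    size-E° : ∀ k → size (E° k) ≡ countSP n F F? k
    size-E° k = trans (length-map fixᵛ (Enumeration.list (solutions F? k))) (sym (countSP-size F? k))

    ¬ins⁺∧rest : ∀ {G G′ G″} {w : Vec (Elem (suc n)) (suc n)} →
                 Inserted Sign.+ G w → ¬ (Inserted Sign.- G′ w ⊎ Fixed G″ w)
    ¬ins⁺∧rest (inserting _ ins) (inj₁ (inserting _ ins′))
      with () ← trans (sym (Insertion.at-zero ins)) (Insertion.at-zero ins′)
    ¬ins⁺∧rest (inserting _ ins) (inj₂ (fixing _ fix))
      with () ← trans (sym (Insertion.at-zero ins)) (Fixing.at-zero fix)

    ¬ins⁻∧fix : ∀ {G G′} {w : Vec (Elem (suc n)) (suc n)} → Inserted Sign.- G w → ¬ Fixed G′ w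
    ¬ins⁻∧fix (inserting _ ins) (fixing _ fix)
      with () ← trans (sym (Insertion.at-zero ins)) (Fixing.at-zero fix)

  -- Without negative values only an insertion with s = + is possible, since both alternatives
  -- create one.
  count-zero : countSP (suc n) C′ C′? 0 ≡ 1 * countSP n C C? 1
  count-zero = trans (countSP-size C′? 0)
    (trans (size-cong (solutions C′? 0) (E⁺ 0) to sol⁺) (size-E⁺ 0))
    where
    to : ∀ {w} → Solution C′ 0 w → Inserted Sign.+ (Solution C 1) w
    to sol with classify sol
    ... | inj₁ ins = ins

  -- This is the coefficient of t^(k+1) in (1+t²)p' + tq, with p counting `C` and q counting `F`.
  -- The summands come from s = +, from s = - and from the adjoined cycle.
  count-suc : ∀ k → countSP (suc n) C′ C′? (suc k) ≡
              suc (suc k) * countSP n C C? (suc (suc k)) + (k * countSP n C C? k + countSP n F F? k)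
  count-suc k = begin
    countSP (suc n) C′ C′? (suc k)                 ≡⟨ countSP-size C′? (suc k) ⟩
    size (solutions C′? (suc k))                   ≡⟨ size-cong (solutions C′? (suc k)) E to from ⟩
    size E                                         ≡⟨ length-++ (Enumeration.list (E⁺ (suc k))) ⟩
    size (E⁺ (suc k)) + size (E⁻ k ⊎ᴱ E° k by ¬ins⁻∧fix)
      ≡⟨ cong₂ _+_ (size-E⁺ (suc k))
           (trans (length-++ (Enumeration.list (E⁻ k))) (cong₂ _+_ (size-E⁻ k) (size-E° k))) ⟩
    suc (suc k) * countSP n C C? (suc (suc k)) + (k * countSP n C C? k + countSP n F F? k) ∎
    where
    open ≡-Reasoning
    E = E⁺ (suc k) ⊎ᴱ (E⁻ k ⊎ᴱ E° k by ¬ins⁻∧fix) by ¬ins⁺∧rest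

    to : ∀ {w} → Solution C′ (suc k) w → Inserted Sign.+ (Solution C (suc (suc k))) w ⊎
         (Inserted Sign.- (Solution C k) w ⊎ Fixed (Solution F k) w)
    to sol with classify sol
    ... | inj₁ ins               = inj₁ ins
    ... | inj₂ (_ , refl , rest) = inj₂ rest

    from : ∀ {w} → Inserted Sign.+ (Solution C (suc (suc k))) w ⊎
           (Inserted Sign.- (Solution C k) w ⊎ Fixed (Solution F k) w) → Solution C′ (suc k) w
    from (inj₁ ins)        = sol⁺ ins
    from (inj₂ (inj₁ ins)) = sol⁻ ins
    from (inj₂ (inj₂ fix)) = sol° fix

  -- The sign of π₁ is s after an insertion and - after a fixing, so π₁ > 0 retains exactly the
  -- insertions with s = +.
  count-positive : ∀ {C⁺ : Map (suc n) → Set} (C⁺? : ∀ g → Dec (C⁺ g)) →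
    (∀ {g} → C⁺ g → C′ g × proj₁ (g zero) ≡ Sign.+) →
    (∀ {g} → C′ g → proj₁ (g zero) ≡ Sign.+ → C⁺ g) →
    ∀ k → countSP (suc n) C⁺ C⁺? k ≡ suc k * countSP n C C? (suc k)
  count-positive {C⁺} C⁺? C⁺⇒ ⇒C⁺ k = trans (countSP-size C⁺? k)
    (trans (size-cong (solutions C⁺? k) (E⁺ k) to from) (size-E⁺ k))
    where
    to : ∀ {w} → Solution C⁺ k w → Inserted Sign.+ (Solution C (suc k)) w
    to (solution perm C⁺w #w) with C′w , pos ← C⁺⇒ C⁺w with classify (solution perm C′w #w)
    ... | inj₁ ins = ins
    ... | inj₂ (_ , _ , inj₁ (inserting _ ins))
      with () ← trans (sym pos) (cong proj₁ (Insertion.at-zero ins))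
    ... | inj₂ (_ , _ , inj₂ (fixing _ fix))
      with () ← trans (sym pos) (cong proj₁ (Fixing.at-zero fix))

    from : ∀ {w} → Inserted Sign.+ (Solution C (suc k)) w → Solution C⁺ k w
    from ins with solution perm C′w #w ← sol⁺ ins =
      solution perm (⇒C⁺ C′w (cong proj₁ (Insertion.at-zero (Inserted.insertion ins)))) #w

-- Derivative polynomials and the recurrences of both classes

t·D : ∀ p k → t· (D p) k ≡ k * p k
t·D p zero    = refl
t·D p (suc k) = refl

-- sec² is the derivative of tan, so R_n(tan) sec² = P_{n+1}(tan) = (1 + tan²) P_n'(tan).
R≗DP : ∀ n k → R n k ≡ D (P n) k
R≗DP zero    zero    = refl
R≗DP zero    (suc k) = sym (ℕP.*-zeroʳ (suc (suc k)))
R≗DP (suc n) zero    rewrite R≗DP n 1 = identity (P n 2)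
  where
  identity : ∀ p → 1 * (2 * p) + 0 + (0 + 0) ≡ 1 * (2 * p + 0)
  identity = solve-∀
R≗DP (suc n) (suc k) rewrite t·D (R n) k | R≗DP n (suc (suc k)) | R≗DP n k =
  -- The factor k from t²R' and the factor 2 from 2tR add up to the `2 + k` of the outer derivative
  -- on the right.
  identity k (P n (3 + k)) (P n (suc k))
  where
  identity : ∀ k p q → (2 + k) * ((3 + k) * p) + k * ((1 + k) * q) + ((1 + k) * q + (1 + k) * q) ≡
                       (2 + k) * ((3 + k) * p + (1 + k) * q)
  identity = solve-∀

-- Here `F` equals `C`: the cycle 1 → -1 → 1 may be adjoined to every cycle-alternating permutation.
𝒞-recurrence : ∀ n →
  𝒞-coeff (suc n) 0 ≡ 1 * 𝒞-coeff n 1 ×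
  (∀ k → 𝒞-coeff (suc n) (suc k) ≡ (2 + k) * 𝒞-coeff n (2 + k) + (k * 𝒞-coeff n k + 𝒞-coeff n k))
𝒞-recurrence n = count-zero , count-suc
  where
  open Recurrence {n} {IsCycleAlternating} {IsCycleAlternating} {IsCycleAlternating}
    isCycleAlternating? isCycleAlternating? isCycleAlternating?
    cycleAlternating⇒alternating
    (λ ins → alternating⇒cycleAlternating ∘ insertion-alternating ins ∘ cycleAlternating⇒alternating)
    (λ ins → alternating⇒cycleAlternating ∘ insertion-alternating⁻ ins ∘ cycleAlternating⇒alternating)
    (λ fix → alternating⇒cycleAlternating ∘ fixing-alternating fix ∘ cycleAlternating⇒alternating)
    (λ fix → alternating⇒cycleAlternating ∘ fixing-alternating⁻ fix ∘ cycleAlternating⇒alternating)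

-- Makes the summand for `F` vanish when adjoining a cycle is impossible.
countSP-⊥ : ∀ n k → countSP n (λ _ → ⊥) (λ _ → no λ ()) k ≡ 0
countSP-⊥ n k = trans (countSP-size {n} {λ _ → ⊥} (λ _ → no λ ()) k) (no-elements list sound)
  where
  open Enumeration (solutions {n} {λ _ → ⊥} (λ _ → no λ ()) k)
  no-elements : ∀ xs → (∀ {v} → v ∈ xs → Solution (λ _ → ⊥) k v) → length xs ≡ 0
  no-elements []       _     = refl
  no-elements (_ ∷ _) none with () ← Solution.satisfies (none (here refl))

CircularAlternating : ∀ {n} → Map n → Set
CircularAlternating f = IsCycleAlternating f × HasOneCycle f

-- From the nonempty size n + 1, adjoining 1 → -1 → 1 would create a second cycle, so `F` is empty.
-- From size 0 the same step does produce a one-cycle permutation, which is why size 1 serves as the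
-- base case.
𝒞°-recurrence : ∀ n →
  𝒞°-coeff (2 + n) 0 ≡ 1 * 𝒞°-coeff (suc n) 1 ×
  (∀ k → 𝒞°-coeff (2 + n) (suc k) ≡ (2 + k) * 𝒞°-coeff (suc n) (2 + k) + k * 𝒞°-coeff (suc n) k) ×
  (∀ k → 𝒞°₊-coeff (suc n) k ≡ suc k * 𝒞°-coeff (suc n) (suc k))
𝒞°-recurrence n = count-zero , count-suc° , count-positive
  (λ g → isCycleAlternating? g ×-dec hasOneCycle? g ×-dec (proj₁ (g zero) SignP.≟ Sign.+))
  (λ (alt , cyc , pos) → (alt , cyc) , pos)
  (λ (alt , cyc) pos → alt , cyc , pos)
  where
  open Recurrence {suc n} {CircularAlternating} {λ _ → ⊥} {CircularAlternating}
    (λ f → isCycleAlternating? f ×-dec hasOneCycle? f)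
    (λ _ → no λ ())
    (λ g → isCycleAlternating? g ×-dec hasOneCycle? g)
    (cycleAlternating⇒alternating ∘ proj₁)
    (λ ins (alt , cyc) →
        alternating⇒cycleAlternating (insertion-alternating ins (cycleAlternating⇒alternating alt))
      , transitive⇒oneCycle (s≤s ℕ.z≤n) (insertion-transitive ins (oneCycle⇒transitive cyc)))
    (λ ins (alt , cyc) →
        alternating⇒cycleAlternating (insertion-alternating⁻ ins (cycleAlternating⇒alternating alt))
      , transitive⇒oneCycle (s≤s ℕ.z≤n) (insertion-transitive⁻ ins (oneCycle⇒transitive cyc)))
    (λ _ ())
    (λ fix (_ , cyc) → fixing-¬transitive fix (s≤s ℕ.z≤n) (oneCycle⇒transitive cyc))

  count-suc° : ∀ k → 𝒞°-coeff (2 + n) (suc k) ≡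
               (2 + k) * 𝒞°-coeff (suc n) (2 + k) + k * 𝒞°-coeff (suc n) k
  count-suc° k = trans (count-suc k) (cong ((2 + k) * 𝒞°-coeff (suc n) (2 + k) +_)
    (trans (cong (k * 𝒞°-coeff (suc n) k +_) (countSP-⊥ (suc n) k)) (ℕP.+-identityʳ _)))

-- Comparison of coefficients

P≗𝒞° : ∀ n k → P n k ≡ 𝒞°-coeff (suc n) k
-- In size 1 only 1 → -1 qualifies, with one negative value, matching `𝕥`.
P≗𝒞° zero    zero          = refl
P≗𝒞° zero    (suc zero)    = refl
P≗𝒞° zero    (suc (suc k)) = refl
P≗𝒞° (suc n) zero          = begin
  1 * P n 1 + 0               ≡⟨ ℕP.+-identityʳ _ ⟩
  1 * P n 1                   ≡⟨ cong (1 *_) (P≗𝒞° n 1) ⟩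
  1 * 𝒞°-coeff (suc n) 1      ≡⟨ proj₁ (𝒞°-recurrence n) ⟨
  𝒞°-coeff (2 + n) 0          ∎
  where open ≡-Reasoning
P≗𝒞° (suc n) (suc k)       = begin
  (2 + k) * P n (2 + k) + t· (D (P n)) k
    ≡⟨ cong₂ _+_ (cong ((2 + k) *_) (P≗𝒞° n (2 + k))) (trans (t·D (P n) k) (cong (k *_) (P≗𝒞° n k))) ⟩
  (2 + k) * 𝒞°-coeff (suc n) (2 + k) + k * 𝒞°-coeff (suc n) k
    ≡⟨ proj₁ (proj₂ (𝒞°-recurrence n)) k ⟨
  𝒞°-coeff (2 + n) (suc k)
    ∎
  where open ≡-Reasoning

Q≗𝒞 : ∀ n k → Q n k ≡ 𝒞-coeff n k
-- In size 0 the empty permutation is counted, without negative values.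
Q≗𝒞 zero    zero    = refl
Q≗𝒞 zero    (suc k) = refl
Q≗𝒞 (suc n) zero    = begin
  1 * Q n 1 + 0 + 0     ≡⟨ trans (ℕP.+-identityʳ _) (ℕP.+-identityʳ _) ⟩
  1 * Q n 1             ≡⟨ cong (1 *_) (Q≗𝒞 n 1) ⟩
  1 * 𝒞-coeff n 1       ≡⟨ proj₁ (𝒞-recurrence n) ⟨
  𝒞-coeff (suc n) 0     ∎
  where open ≡-Reasoning
Q≗𝒞 (suc n) (suc k) = begin
  (2 + k) * Q n (2 + k) + t· (D (Q n)) k + Q n k
    ≡⟨ cong (λ q → (2 + k) * Q n (2 + k) + q + Q n k) (t·D (Q n) k) ⟩
  (2 + k) * Q n (2 + k) + k * Q n k + Q n k
    ≡⟨ ℕP.+-assoc ((2 + k) * Q n (2 + k)) (k * Q n k) (Q n k) ⟩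
  (2 + k) * Q n (2 + k) + (k * Q n k + Q n k)
    ≡⟨ cong₂ (λ p q → (2 + k) * p + (k * q + q)) (Q≗𝒞 n (2 + k)) (Q≗𝒞 n k) ⟩
  (2 + k) * 𝒞-coeff n (2 + k) + (k * 𝒞-coeff n k + 𝒞-coeff n k)
    ≡⟨ proj₂ (𝒞-recurrence n) k ⟨
  𝒞-coeff (suc n) (suc k)
    ∎
  where open ≡-Reasoning

-- Both sides are the derivative of P_n: the count arises by subdividing the crossing arrows of
-- one-cycle permutations of size n + 1 with s = +.
R≗𝒞°₊ : ∀ n k → R n k ≡ 𝒞°₊-coeff (suc n) k
R≗𝒞°₊ n k = begin
  R n k                                ≡⟨ R≗DP n k ⟩
  suc k * P n (suc k)                  ≡⟨ cong (suc k *_) (P≗𝒞° n (suc k)) ⟩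
  suc k * 𝒞°-coeff (suc n) (suc k)     ≡⟨ proj₂ (proj₂ (𝒞°-recurrence n)) k ⟨
  𝒞°₊-coeff (suc n) k                  ∎
  where open ≡-Reasoning

theorem3p10 : ∀ (n k : ℕ) →
    (P n k ≡ 𝒞°-coeff (suc n) k) × (Q n k ≡ 𝒞-coeff n k) × (R n k ≡ 𝒞°₊-coeff (suc n) k)
theorem3p10 n k = P≗𝒞° n k , Q≗𝒞 n k , R≗𝒞°₊ n k
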